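{- For all $n \ge 3$, $N_{1,2}(n) = 1$.
   Context: For positive integers $a<b$ and $n \ge 3$, an $(a,b)$-necklace of length $n$ is a circular arrangement of the integers $0,1,\ldots,n-1$ (each used exactly once) such that any two adjacent entries have difference $\pm a$ or $\pm b$. Two necklaces are considered the same if one is obtained from the other by rotation or reflection. $N_{a,b}(n)$ denotes the number of distinct $(a,b)$-necklaces of length $n$; equivalently, it is the number of Hamiltonian cycles (as undirected subgraphs) of the graph on $\{0,1,\ldots,n-1\}$ in which $x,y$ are adjacent if and only if $|x-y| \in \{a,b\}$. -}

module Defs where

open import Data.Fin using (Fin; toℕ; opposite)
open import Data.Fin.Properties using (any?; all?) renaming (_≟_ to _≟ᶠ_)
open import Data.List using (List; []; _∷_; length; filter; deduplicate; allFin; cartesianProductWith)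
open import Data.List.Membership.Propositional using (_∈_)
open import Data.List.Membership.Propositional.Properties using (∈-cartesianProductWith⁺; ∈-allFin)
open import Data.List.Relation.Unary.Any using (here)
open import Data.Nat using (ℕ; zero; suc; _+_; _≟_; ∣_-_∣)
open import Data.Nat.DivMod using (_mod_)
open import Data.Product using (∃; ∃!; _,_)
open import Data.Sum using (_⊎_)
open import Data.Vec using (Vec; []; _∷_; lookup)
open import Relation.Binary.PropositionalEquality using (_≡_; refl)
open import Relation.Nullary using (Dec)
open import Relation.Nullary.Decidable using (map′; _×-dec_; _⊎-dec_; _→-dec_)

-- The entry at position i of the circle is lookup w i; the integers
-- 0, …, n - 1 are represented by Fin n.
Word : ℕ → Set
Word n = Vec (Fin n) n

-- Position i + k modulo n.
shift : ∀ {n} → ℕ → Fin n → Fin n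
shift {suc n} k i = (toℕ i + k) mod suc n

EachOnce : ∀ {n} → Word n → Set
EachOnce w = ∀ x → ∃! _≡_ λ i → lookup w i ≡ x

-- x and y differ by ± a or ± b.
Adjacent : ∀ {n} → ℕ → ℕ → Fin n → Fin n → Set
Adjacent a b x y = ∣ toℕ x - toℕ y ∣ ≡ a ⊎ ∣ toℕ x - toℕ y ∣ ≡ b

record IsNecklace {n : ℕ} (a b : ℕ) (w : Word n) : Set where
  constructor isNecklace
  field
    eachOnce : EachOnce w
    adjacent : ∀ i → Adjacent a b (lookup w i) (lookup w (shift 1 i))

Rotation : ∀ {n} → Word n → Word n → Set
Rotation {n} v w = ∃ λ (k : Fin n) → ∀ i → lookup v i ≡ lookup w (shift (toℕ k) i)

-- opposite i is position n - 1 - i, so this covers a reflection in any axis.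
Reflection : ∀ {n} → Word n → Word n → Set
Reflection {n} v w =
  ∃ λ (k : Fin n) → ∀ i → lookup v i ≡ lookup w (shift (toℕ k) (opposite i))

Same : ∀ {n} → Word n → Word n → Set
Same v w = Rotation v w ⊎ Reflection v w

eachOnce? : ∀ {n} (w : Word n) → Dec (EachOnce w)
eachOnce? w = all? λ x → any? λ i →
  (lookup w i ≟ᶠ x) ×-dec
  map′ (λ f {j} → f j) (λ f j → f {j})
       (all? λ j → (lookup w j ≟ᶠ x) →-dec (i ≟ᶠ j))

adjacent? : ∀ {n} a b (x y : Fin n) → Dec (Adjacent a b x y)
adjacent? a b x y =
  (∣ toℕ x - toℕ y ∣ ≟ a) ⊎-dec (∣ toℕ x - toℕ y ∣ ≟ b)

isNecklace? : ∀ {n} a b (w : Word n) → Dec (IsNecklace a b w)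
isNecklace? a b w =
  map′ (λ (p , q) → isNecklace p q) (λ (isNecklace p q) → p , q)
    (eachOnce? w ×-dec (all? λ i → adjacent? a b (lookup w i) (lookup w (shift 1 i))))

same? : ∀ {n} (v w : Word n) → Dec (Same v w)
same? v w =
  (any? λ k → all? λ i → lookup v i ≟ᶠ lookup w (shift (toℕ k) i)) ⊎-dec
  (any? λ k → all? λ i → lookup v i ≟ᶠ lookup w (shift (toℕ k) (opposite i)))

vectors : ∀ {A : Set} → List A → (m : ℕ) → List (Vec A m)
vectors xs zero    = [] ∷ []
vectors xs (suc m) = cartesianProductWith _∷_ xs (vectors xs m)

words : ∀ n → List (Word n)
words n = vectors (allFin n) n

-- No word is missed by the count below.
∈-words : ∀ {n} (w : Word n) → w ∈ words n
∈-words {n} = go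
  where
  go : ∀ {m} (v : Vec (Fin n) m) → v ∈ vectors (allFin n) m
  go []      = here refl
  go (x ∷ v) = ∈-cartesianProductWith⁺ _∷_ (∈-allFin x) (go v)

-- The number of (a,b)-necklaces of length n: list all words that are
-- necklaces, keep one from each rotation/reflection class, and count.
-- It is of interest for 0 < a < b and n ≥ 3, but makes sense for all
-- arguments.
N : (a b n : ℕ) → ℕ
N a b n = length (deduplicate same? (filter (isNecklace? a b) (words n)))

{-# OPTIONS --safe #-}
-- Call the place i odd or even according as i < n - 1 - i or not, and put
-- 1 + 2 i at an odd place and 2 (n - 1 - i) at an even one.  This gives the
-- necklace 1, 3, 5, …, 4, 2, 0.  Conversely, turn and flip any necklace until
-- 0 is in the last place and 1 in the first.  The place where the zigzag has
-- v + 2 is adjacent to the place where it has v.  By induction the values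
-- below v + 2 are already where the zigzag has them, so this place holds a
-- number that is at least v + 2, and at most v + 2 because of its neighbour v.
module Submission where

open import Defs
open import Data.Fin using (Fin; zero; suc; toℕ; fromℕ<; opposite)
open import Data.Fin.Properties
  using (toℕ-injective; toℕ-fromℕ<; toℕ<n; toℕ≤pred[n]; opposite-prop; opposite-involutive)
open import Data.List using (_∷_; length; deduplicate)
open import Data.List.Membership.Propositional using (_∈_)
open import Data.List.Membership.Propositional.Properties using (∈-filter⁺)
open import Data.List.Properties using (filter-none)
open import Data.List.Relation.Unary.All using (All; _∷_) renaming (map to mapAll)
open import Data.List.Relation.Unary.All.Properties using (all-filter; deduplicate⁺)
open import Data.Nat
  using (ℕ; zero; suc; _+_; _*_; _%_; _≤_; _<_; _≥_; z≤n; s≤s; s≤s⁻¹; ∣_-_∣)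
open import Data.Nat.DivMod
  using (_mod_; %-distribˡ-+; m%n%n≡m%n; [m+kn]%n≡m%n; m<n⇒m%n≡m; n%n≡0)
open import Data.Nat.Induction using (<-rec)
open import Data.Nat.Properties
open import Data.Product using (∃; _×_; _,_; proj₁; proj₂)
open import Data.Sum using (_⊎_; inj₁; inj₂) renaming (map to map⊎)
open import Data.Vec using (lookup; tabulate)
open import Data.Vec.Properties using (lookup∘tabulate)
open import Function using (_∘_; case_of_)
open import Level using (0ℓ)
open import Relation.Binary using (Rel; Decidable)
open import Relation.Binary.PropositionalEquality
  using (_≡_; _≢_; _≗_; refl; sym; trans; cong; cong₂; subst; subst₂; module ≡-Reasoning)
open import Relation.Nullary using (¬_; contradiction)

private variable
  m : ℕ

-- Arithmetic of doubles

double-injective : ∀ i j → i + i ≡ j + j → i ≡ j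
double-injective zero    zero    _  = refl
double-injective (suc i) (suc j) eq = cong suc (double-injective i j (suc-injective (begin
  suc (i + i) ≡⟨ +-suc i i ⟨
  i + suc i   ≡⟨ suc-injective eq ⟩
  j + suc j   ≡⟨ +-suc j j ⟩
  suc (j + j) ∎)))
  where open ≡-Reasoning

double-suc : ∀ i → suc i + suc i ≡ 2 + (i + i)
double-suc i = cong suc (+-suc i i)

double≢suc-double : ∀ i j → i + i ≢ suc (j + j)
double≢suc-double (suc i) zero    eq = case trans (sym (+-suc i i)) (suc-injective eq) of λ ()
double≢suc-double (suc i) (suc j) eq = double≢suc-double i j (suc-injective (suc-injective (begin
  2 + (i + i)     ≡⟨ double-suc i ⟨
  suc i + suc i   ≡⟨ eq ⟩
  suc (suc j + suc j) ≡⟨ cong suc (double-suc j) ⟩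
  3 + (j + j)     ∎)))
  where open ≡-Reasoning

-- The parity of a value decides which arm of the zigzag holds it, and k is its distance from the
-- outer end of that arm.
halve : ∀ v → ∃ λ k → v ≡ suc (k + k) ⊎ v ≡ k + k
halve zero = 0 , inj₂ refl
halve (suc v) with halve v
... | k , inj₁ refl = suc k , inj₂ (sym (double-suc k))
... | k , inj₂ refl = k , inj₁ refl

-- The dihedral group acting on places

toℕ-shift : ∀ k (i : Fin (suc m)) → toℕ (shift k i) ≡ (toℕ i + k) % suc m
toℕ-shift k i = toℕ-fromℕ< _

toℕ+opposite : (i : Fin (suc m)) → toℕ i + toℕ (opposite i) ≡ m
toℕ+opposite i = trans (cong (toℕ i +_) (opposite-prop i)) (m+[n∸m]≡n (toℕ≤pred[n] i))

opposite-injective : {i j : Fin (suc m)} → opposite i ≡ opposite j → i ≡ j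
opposite-injective {i = i} {j} eq =
  trans (sym (opposite-involutive i)) (trans (cong opposite eq) (opposite-involutive j))

shift-shift : ∀ a b (i : Fin (suc m)) → shift a (shift b i) ≡ shift (b + a) i
shift-shift {m} a b i = toℕ-injective (begin
  toℕ (shift a (shift b i))                    ≡⟨ toℕ-shift a (shift b i) ⟩
  (toℕ (shift b i) + a) % n                    ≡⟨ cong (λ x → (x + a) % n) (toℕ-shift b i) ⟩
  ((toℕ i + b) % n + a) % n                    ≡⟨ %-distribˡ-+ ((toℕ i + b) % n) a n ⟩
  ((toℕ i + b) % n % n + a % n) % n            ≡⟨ cong (λ x → (x + a % n) % n) (m%n%n≡m%n (toℕ i + b) n) ⟩
  ((toℕ i + b) % n + a % n) % n                ≡⟨ %-distribˡ-+ (toℕ i + b) a n ⟨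
  (toℕ i + b + a) % n                          ≡⟨ cong (_% n) (+-assoc (toℕ i) b a) ⟩
  (toℕ i + (b + a)) % n                        ≡⟨ toℕ-shift (b + a) i ⟨
  toℕ (shift (b + a) i)                        ∎)
  where open ≡-Reasoning
        n = suc m

shift-multiple : ∀ k (i : Fin (suc m)) → shift (k * suc m) i ≡ i
shift-multiple {m} k i = toℕ-injective (trans (toℕ-shift (k * suc m) i)
  (trans ([m+kn]%n≡m%n (toℕ i) k (suc m)) (m<n⇒m%n≡m (toℕ<n i))))

shift-mod : ∀ k (i : Fin (suc m)) → shift (toℕ (k mod suc m)) i ≡ shift k i
shift-mod {m} k i = toℕ-injective (begin
  toℕ (shift (toℕ (k mod n)) i)     ≡⟨ toℕ-shift (toℕ (k mod n)) i ⟩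
  (toℕ i + toℕ (k mod n)) % n       ≡⟨ cong (λ x → (toℕ i + x) % n) (toℕ-fromℕ< _) ⟩
  (toℕ i + k % n) % n               ≡⟨ %-distribˡ-+ (toℕ i) (k % n) n ⟩
  (toℕ i % n + k % n % n) % n       ≡⟨ cong (λ x → (toℕ i % n + x) % n) (m%n%n≡m%n k n) ⟩
  (toℕ i % n + k % n) % n           ≡⟨ %-distribˡ-+ (toℕ i) k n ⟨
  (toℕ i + k) % n                   ≡⟨ toℕ-shift k i ⟨
  toℕ (shift k i)                   ∎)
  where open ≡-Reasoning
        n = suc m

-- The cyclic successor relation. The passage from the last place to the first is a case of its own,
-- so that proofs can split on it instead of computing remainders.
data Step {m} (i j : Fin (suc m)) : Set where
  wrap : toℕ i ≡ m → toℕ j ≡ 0 → Step i j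
  next : toℕ j ≡ suc (toℕ i) → Step i j

step⇒shift : {i j : Fin (suc m)} → Step i j → shift 1 i ≡ j
step⇒shift {m} {i} {j} (wrap i≡m j≡0) = toℕ-injective (begin
  toℕ (shift 1 i)      ≡⟨ toℕ-shift 1 i ⟩
  (toℕ i + 1) % suc m  ≡⟨ cong (_% suc m) (trans (+-comm (toℕ i) 1) (cong suc i≡m)) ⟩
  suc m % suc m        ≡⟨ n%n≡0 (suc m) ⟩
  0                    ≡⟨ j≡0 ⟨
  toℕ j                ∎)
  where open ≡-Reasoning
step⇒shift {m} {i} {j} (next j≡1+i) = toℕ-injective (begin
  toℕ (shift 1 i)      ≡⟨ toℕ-shift 1 i ⟩
  (toℕ i + 1) % suc m  ≡⟨ cong (_% suc m) (trans (+-comm (toℕ i) 1) (sym j≡1+i)) ⟩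
  toℕ j % suc m        ≡⟨ m<n⇒m%n≡m (toℕ<n j) ⟩
  toℕ j                ∎)
  where open ≡-Reasoning

step-shift : (i : Fin (suc m)) → Step i (shift 1 i)
step-shift {m} i with m≤n⇒m<n∨m≡n (toℕ≤pred[n] i)
... | inj₁ i<m = next (trans (toℕ-shift 1 i)
        (trans (cong (_% suc m) (+-comm (toℕ i) 1)) (m<n⇒m%n≡m (s≤s i<m))))
... | inj₂ i≡m = wrap i≡m (trans (toℕ-shift 1 i)
        (trans (cong (_% suc m) (trans (+-comm (toℕ i) 1) (cong suc i≡m))) (n%n≡0 (suc m))))

next-opposite : {i j : Fin (suc m)} → toℕ j ≡ suc (toℕ i) → toℕ (opposite i) ≡ suc (toℕ (opposite j))
next-opposite {i = i} {j} j≡1+i = +-cancelˡ-≡ (toℕ i) _ _ (begin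
  toℕ i + toℕ (opposite i)        ≡⟨ toℕ+opposite i ⟩
  _                               ≡⟨ toℕ+opposite j ⟨
  toℕ j + toℕ (opposite j)        ≡⟨ cong (_+ toℕ (opposite j)) j≡1+i ⟩
  suc (toℕ i + toℕ (opposite j))  ≡⟨ +-suc (toℕ i) _ ⟨
  toℕ i + suc (toℕ (opposite j))  ∎)
  where open ≡-Reasoning

opposite-first : {i : Fin (suc m)} → toℕ i ≡ 0 → toℕ (opposite i) ≡ m
opposite-first {m} {i} i≡0 = subst (λ x → x + toℕ (opposite i) ≡ m) i≡0 (toℕ+opposite i)

opposite-last : {i : Fin (suc m)} → toℕ i ≡ m → toℕ (opposite i) ≡ 0
opposite-last {m} {i} i≡m = +-cancelˡ-≡ m _ _ (begin
  m + toℕ (opposite i)      ≡⟨ cong (_+ toℕ (opposite i)) i≡m ⟨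
  toℕ i + toℕ (opposite i)  ≡⟨ toℕ+opposite i ⟩
  m                         ≡⟨ +-identityʳ m ⟨
  m + 0                     ∎)
  where open ≡-Reasoning

step-opposite : {i j : Fin (suc m)} → Step i j → Step (opposite j) (opposite i)
step-opposite {i = i} {j} (wrap i≡m j≡0) = wrap (opposite-first {i = j} j≡0) (opposite-last {i = i} i≡m)
step-opposite {i = i} {j} (next j≡1+i)   = next (next-opposite {i = i} {j} j≡1+i)

-- Conjugating a rotation by a reflection inverts it. Since m is -1 modulo `suc m`, a shift by
-- `k * m` is a shift back by k, written without subtraction.
opposite-shift : ∀ k (i : Fin (suc m)) → opposite (shift k i) ≡ shift (k * m) (opposite i)
opposite-shift zero i = trans (cong opposite (shift-multiple 0 i)) (sym (shift-multiple 0 (opposite i)))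
opposite-shift {m} (suc k) i = begin
  opposite (shift (suc k) i)            ≡⟨ cong (λ x → opposite (shift x i)) (+-comm 1 k) ⟩
  opposite (shift (k + 1) i)            ≡⟨ cong opposite (shift-shift 1 k i) ⟨
  opposite (shift 1 (shift k i))        ≡⟨ once (shift k i) ⟩
  shift m (opposite (shift k i))        ≡⟨ cong (shift m) (opposite-shift k i) ⟩
  shift m (shift (k * m) (opposite i))  ≡⟨ shift-shift m (k * m) (opposite i) ⟩
  shift (k * m + m) (opposite i)        ≡⟨ cong (λ x → shift x (opposite i)) (+-comm (k * m) m) ⟩
  shift (suc k * m) (opposite i)        ∎
  where
  open ≡-Reasoning
  once : ∀ j → opposite (shift 1 j) ≡ shift m (opposite j)
  once j = begin
    -- A full turn is inserted and split into `shift 1` and `shift m`. The `shift 1` then cancels,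
    -- because `opposite` reverses steps.
    opposite (shift 1 j)                      ≡⟨ shift-multiple 1 (opposite (shift 1 j)) ⟨
    shift (1 * suc m) (opposite (shift 1 j))  ≡⟨ cong (λ x → shift x (opposite (shift 1 j))) (*-identityˡ (suc m)) ⟩
    shift (1 + m) (opposite (shift 1 j))      ≡⟨ shift-shift m 1 (opposite (shift 1 j)) ⟨
    shift m (shift 1 (opposite (shift 1 j)))  ≡⟨ cong (shift m) (step⇒shift (step-opposite (step-shift j))) ⟩
    shift m (opposite j)                      ∎

-- The amount k is any natural number, so that composites and inverses need no reduction.
-- `shift-mod` brings it into the range that `Same` demands. Pointwise equality takes the place of
-- function extensionality.
IsSymmetry : (Fin (suc m) → Fin (suc m)) → Set
IsSymmetry σ = (∃ λ k → σ ≗ shift k) ⊎ (∃ λ k → σ ≗ shift k ∘ opposite)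

-- Amounts of rotation add up. When the left factor is a reflection, the amount b on its right is
-- inverted first and becomes `b * m`.
∘-isSymmetry : {σ τ : Fin (suc m) → Fin (suc m)} → IsSymmetry σ → IsSymmetry τ → IsSymmetry (σ ∘ τ)
∘-isSymmetry {τ = τ} (inj₁ (a , p)) (inj₁ (b , q)) = inj₁ (b + a , λ i →
  trans (p (τ i)) (trans (cong (shift a) (q i)) (shift-shift a b i)))
∘-isSymmetry {τ = τ} (inj₁ (a , p)) (inj₂ (b , q)) = inj₂ (b + a , λ i →
  trans (p (τ i)) (trans (cong (shift a) (q i)) (shift-shift a b (opposite i))))
∘-isSymmetry {m} {τ = τ} (inj₂ (a , p)) (inj₁ (b , q)) = inj₂ (b * m + a , λ i →
  trans (p (τ i)) (trans (cong (shift a) (trans (cong opposite (q i)) (opposite-shift b i)))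
                         (shift-shift a (b * m) (opposite i))))
∘-isSymmetry {m} {τ = τ} (inj₂ (a , p)) (inj₂ (b , q)) = inj₁ (b * m + a , λ i →
  trans (p (τ i)) (trans (cong (shift a) (trans (cong opposite (q i))
                           (trans (opposite-shift b (opposite i))
                                  (cong (shift (b * m)) (opposite-involutive i)))))
                         (shift-shift a (b * m) i)))

-- A shift by k followed by one by `k * m` amounts to k full turns. A reflection is its own inverse.
symmetry-inverse : {σ : Fin (suc m) → Fin (suc m)} → IsSymmetry σ →
                   ∃ λ τ → IsSymmetry τ × (∀ i → τ (σ i) ≡ i) × (∀ i → σ (τ i) ≡ i)
symmetry-inverse {m} {σ} (inj₁ (k , p)) = shift (k * m) , inj₁ (k * m , λ _ → refl) ,
  (λ i → trans (cong (shift (k * m)) (p i)) (trans (shift-shift (k * m) k i)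
           (trans (cong (λ x → shift x i) (sym (*-suc k m))) (shift-multiple k i)))) ,
  (λ i → trans (p (shift (k * m) i)) (trans (shift-shift k (k * m) i)
           (trans (cong (λ x → shift x i) (trans (+-comm (k * m) k) (sym (*-suc k m)))) (shift-multiple k i))))
symmetry-inverse {m} {σ} (inj₂ (k , p)) = σ , inj₂ (k , p) , involutive , involutive
  where
  involutive : ∀ i → σ (σ i) ≡ i
  involutive i = begin
    σ (σ i)                                            ≡⟨ trans (cong σ (p i)) (p (shift k (opposite i))) ⟩
    shift k (opposite (shift k (opposite i)))          ≡⟨ cong (shift k) (opposite-shift k (opposite i)) ⟩
    shift k (shift (k * m) (opposite (opposite i)))    ≡⟨ shift-shift k (k * m) (opposite (opposite i)) ⟩
    shift (k * m + k) (opposite (opposite i))          ≡⟨ cong₂ shift (trans (+-comm (k * m) k) (sym (*-suc k m)))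
                                                                      (opposite-involutive i) ⟩
    shift (k * suc m) i                                ≡⟨ shift-multiple k i ⟩
    i                                                  ∎
    where open ≡-Reasoning

symmetry-injective : {σ : Fin (suc m) → Fin (suc m)} → IsSymmetry σ → ∀ {i j} → σ i ≡ σ j → i ≡ j
symmetry-injective s {i} {j} eq = let τ , _ , τσ , _ = symmetry-inverse s in
  trans (sym (τσ i)) (trans (cong τ eq) (τσ j))

-- Rotations keep the direction of a step and reflections reverse it. Either outcome serves, because
-- `Adjacent` is symmetric.
symmetry-step : {σ : Fin (suc m) → Fin (suc m)} → IsSymmetry σ → ∀ {i j} → Step i j →
                shift 1 (σ i) ≡ σ j ⊎ shift 1 (σ j) ≡ σ i
symmetry-step {σ = σ} (inj₁ (k , p)) {i} {j} s = inj₁ (begin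
  shift 1 (σ i)        ≡⟨ cong (shift 1) (p i) ⟩
  shift 1 (shift k i)  ≡⟨ shift-shift 1 k i ⟩
  shift (k + 1) i      ≡⟨ cong (λ x → shift x i) (+-comm k 1) ⟩
  shift (1 + k) i      ≡⟨ shift-shift k 1 i ⟨
  shift k (shift 1 i)  ≡⟨ cong (shift k) (step⇒shift s) ⟩
  shift k j            ≡⟨ p j ⟨
  σ j                  ∎)
  where open ≡-Reasoning
symmetry-step {σ = σ} (inj₂ (k , p)) {i} {j} s = inj₂ (begin
  shift 1 (σ j)                   ≡⟨ cong (shift 1) (p j) ⟩
  shift 1 (shift k (opposite j))  ≡⟨ shift-shift 1 k (opposite j) ⟩
  shift (k + 1) (opposite j)      ≡⟨ cong (λ x → shift x (opposite j)) (+-comm k 1) ⟩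
  shift (1 + k) (opposite j)      ≡⟨ shift-shift k 1 (opposite j) ⟨
  shift k (shift 1 (opposite j))  ≡⟨ cong (shift k) (step⇒shift (step-opposite s)) ⟩
  shift k (opposite i)            ≡⟨ p i ⟨
  σ i                             ∎)
  where open ≡-Reasoning

symmetry⇒same : {v w : Word (suc m)} {σ : Fin (suc m) → Fin (suc m)} → IsSymmetry σ →
                (∀ i → lookup v i ≡ lookup w (σ i)) → Same v w
symmetry⇒same {m} {w = w} (inj₁ (k , p)) eq = inj₁ (k mod suc m , λ i →
  trans (eq i) (cong (lookup w) (trans (p i) (sym (shift-mod k i)))))
symmetry⇒same {m} {w = w} (inj₂ (k , p)) eq = inj₂ (k mod suc m , λ i →
  trans (eq i) (cong (lookup w) (trans (p i) (sym (shift-mod k (opposite i))))))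

-- The zigzag

-- The zigzag as a relation, so that it can be read from place to value and from value to place. The
-- constructors are named after the parity of v; the side conditions divide the circle into a rising
-- first half and a falling second half.
data Zigzag {m} (i v : Fin (suc m)) : Set where
  odd  : toℕ i < toℕ (opposite i) → toℕ v ≡ suc (toℕ i + toℕ i) → Zigzag i v
  even : toℕ (opposite i) ≤ toℕ i → toℕ v ≡ toℕ (opposite i) + toℕ (opposite i) → Zigzag i v

-- The value stays within `m` because it is bounded by `toℕ i + toℕ (opposite i)`: the smaller
-- summand is doubled, and in the odd case the inequality is strict, which makes room for the extra
-- 1.
zigzag-total : (i : Fin (suc m)) → ∃ (Zigzag i)
zigzag-total {m} i with <-≤-connex (toℕ i) (toℕ (opposite i))
... | inj₁ i<o = fromℕ< (s≤s bound) , odd i<o (toℕ-fromℕ< (s≤s bound))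
  where
  bound : suc (toℕ i + toℕ i) ≤ m
  bound = subst₂ _≤_ (+-suc (toℕ i) (toℕ i)) (toℕ+opposite i) (+-monoʳ-≤ (toℕ i) i<o)
... | inj₂ o≤i = fromℕ< (s≤s bound) , even o≤i (toℕ-fromℕ< (s≤s bound))
  where
  bound : toℕ (opposite i) + toℕ (opposite i) ≤ m
  bound = subst (toℕ (opposite i) + toℕ (opposite i) ≤_) (toℕ+opposite i) (+-monoˡ-≤ (toℕ (opposite i)) o≤i)

zigzag-functional : {i u v : Fin (suc m)} → Zigzag i u → Zigzag i v → u ≡ v
zigzag-functional (odd _ p)    (odd _ q)    = toℕ-injective (trans p (sym q))
zigzag-functional (odd i<o _)  (even o≤i _) = contradiction o≤i (<⇒≱ i<o)
zigzag-functional (even o≤i _) (odd i<o _)  = contradiction o≤i (<⇒≱ i<o)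
zigzag-functional (even _ p)   (even _ q)   = toℕ-injective (trans p (sym q))

-- The parity of v fixes the constructor, and then halving recovers `i` or `opposite i`.
zigzag-injective : {i j v : Fin (suc m)} → Zigzag i v → Zigzag j v → i ≡ j
zigzag-injective {i = i} {j} (odd _ p)  (odd _ q)  =
  toℕ-injective (double-injective (toℕ i) (toℕ j) (suc-injective (trans (sym p) q)))
zigzag-injective {i = i} {j} (odd _ p)  (even _ q) =
  contradiction (trans (sym q) p) (double≢suc-double (toℕ (opposite j)) (toℕ i))
zigzag-injective {i = i} {j} (even _ p) (odd _ q)  =
  contradiction (trans (sym p) q) (double≢suc-double (toℕ (opposite i)) (toℕ j))
zigzag-injective {i = i} {j} (even _ p) (even _ q) =
  opposite-injective (toℕ-injective (double-injective (toℕ (opposite i)) (toℕ (opposite j)) (trans (sym p) q)))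

-- The value `suc (k + k)` belongs at place k and the value `k + k` at the place opposite to k. That
-- v is at most m is just what puts this place in the correct half.
zigzag-surjective : (v : Fin (suc m)) → ∃ λ i → Zigzag i v
zigzag-surjective {m} v with halve (toℕ v)
... | k , inj₁ v≡1+2k = i , odd i<o (trans v≡1+2k (cong (λ x → suc (x + x)) (sym i≡k)))
  where
  1+2k≤m : suc (k + k) ≤ m
  1+2k≤m = subst (_≤ m) v≡1+2k (toℕ≤pred[n] v)
  k<n : k < suc m
  k<n = s≤s (≤-trans (m≤m+n k k) (≤-trans (n≤1+n _) 1+2k≤m))
  i = fromℕ< k<n
  i≡k : toℕ i ≡ k
  i≡k = toℕ-fromℕ< k<n
  i<o : toℕ i < toℕ (opposite i)
  i<o = +-cancelˡ-≤ (toℕ i) _ _ (subst₂ _≤_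
    (trans (cong (λ x → suc (x + x)) (sym i≡k)) (sym (+-suc (toℕ i) (toℕ i))))
    (sym (toℕ+opposite i)) 1+2k≤m)
... | k , inj₂ v≡2k = opposite i , even o≤i (trans v≡2k (cong (λ x → x + x) (sym o≡k)))
  where
  2k≤m : k + k ≤ m
  2k≤m = subst (_≤ m) v≡2k (toℕ≤pred[n] v)
  k<n : k < suc m
  k<n = s≤s (≤-trans (m≤m+n k k) 2k≤m)
  i = fromℕ< k<n
  o≡k : toℕ (opposite (opposite i)) ≡ k
  o≡k = trans (cong toℕ (opposite-involutive i)) (toℕ-fromℕ< k<n)
  o≤i : toℕ (opposite (opposite i)) ≤ toℕ (opposite i)
  o≤i = +-cancelʳ-≤ (toℕ (opposite (opposite i))) _ _ (subst₂ _≤_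
    (cong (λ x → x + x) (sym o≡k)) (sym (toℕ+opposite (opposite i))) 2k≤m)

-- Neighbouring places and neighbouring values in the zigzag

adjacent-sym : ∀ {n a b} (x y : Fin n) → Adjacent a b x y → Adjacent a b y x
adjacent-sym x y = map⊎ (trans (∣-∣-comm (toℕ y) (toℕ x))) (trans (∣-∣-comm (toℕ y) (toℕ x)))

-- Values change by 2 along either half, and by 1 at the two turns: in the middle, and between the
-- last place and the first.
zigzag-adjacent : {i j u v : Fin (suc (suc m))} → Step i j → Zigzag i u → Zigzag j v → Adjacent 1 2 u v
zigzag-adjacent {i = i} (wrap i≡m _) (odd i<o _) _ =
  contradiction (subst (toℕ (opposite i) ≤_) (sym i≡m) (toℕ≤pred[n] (opposite i))) (<⇒≱ i<o)
-- The first place is not even, since the length is at least 2.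
zigzag-adjacent {j = j} (wrap _ j≡0) (even _ _) (even o≤j _) =
  case subst₂ _≤_ (opposite-first {i = j} j≡0) j≡0 o≤j of λ ()
zigzag-adjacent {i = i} (wrap i≡m j≡0) (even _ u≡2o) (odd _ v≡1+2j) = inj₁ (cong₂ ∣_-_∣
  (trans u≡2o (cong (λ x → x + x) (opposite-last {i = i} i≡m)))
  (trans v≡1+2j (cong (λ x → suc (x + x)) j≡0)))
zigzag-adjacent {i = i} {j} {u} {v} (next j≡1+i) (odd _ u≡1+2i) (odd _ v≡1+2j) = inj₂ (begin
  ∣ toℕ u - toℕ v ∣                  ≡⟨ cong₂ ∣_-_∣ u≡1+2i v≡1+2j ⟩
  ∣ x + x - toℕ j + toℕ j ∣          ≡⟨ cong (λ y → ∣ x + x - y + y ∣) j≡1+i ⟩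
  ∣ x + x - suc x + suc x ∣          ≡⟨ cong (∣ x + x -_∣) (trans (double-suc x) (+-comm 2 (x + x))) ⟩
  ∣ x + x - x + x + 2 ∣              ≡⟨ ∣m-m+n∣≡n (x + x) 2 ⟩
  2                                  ∎)
  where
  open ≡-Reasoning
  x = toℕ i
-- This is the turn in the middle, where `toℕ (opposite j)` is either `toℕ i` or its successor. The
-- first happens for even length, with the largest value at i, the second for odd length, with the
-- largest value at j.
zigzag-adjacent {i = i} {j} {u} {v} (next j≡1+i) (odd i<o u≡1+2i) (even o≤j v≡2o)
  with m≤n⇒m<n∨m≡n (subst (toℕ (opposite j) ≤_) j≡1+i o≤j)
... | inj₁ o<1+i = inj₁ (begin
  ∣ toℕ u - toℕ v ∣                           ≡⟨ cong₂ ∣_-_∣ u≡1+2i v≡2o ⟩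
  ∣ suc (x + x) - o + o ∣                     ≡⟨ cong (λ y → ∣ suc (x + x) - y + y ∣) o≡x ⟩
  ∣ suc (x + x) - x + x ∣                     ≡⟨ ∣-∣-comm (suc (x + x)) (x + x) ⟩
  ∣ x + x - suc (x + x) ∣                     ≡⟨ cong (∣ x + x -_∣) (+-comm 1 (x + x)) ⟩
  ∣ x + x - x + x + 1 ∣                       ≡⟨ ∣m-m+n∣≡n (x + x) 1 ⟩
  1                                           ∎)
  where
  open ≡-Reasoning
  x = toℕ i
  o = toℕ (opposite j)
  o≡x : o ≡ x
  o≡x = ≤-antisym (s≤s⁻¹ o<1+i) (s≤s⁻¹ (subst (x <_) (next-opposite {i = i} {j} j≡1+i) i<o))
... | inj₂ o≡1+i = inj₁ (begin
  ∣ toℕ u - toℕ v ∣                           ≡⟨ cong₂ ∣_-_∣ u≡1+2i (trans v≡2o (cong (λ y → y + y) o≡1+i)) ⟩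
  ∣ suc (x + x) - suc x + suc x ∣             ≡⟨ cong (∣ suc (x + x) -_∣)
                                                    (trans (double-suc x) (+-comm 1 (suc (x + x)))) ⟩
  ∣ suc (x + x) - suc (x + x) + 1 ∣           ≡⟨ ∣m-m+n∣≡n (suc (x + x)) 1 ⟩
  1                                           ∎)
  where
  open ≡-Reasoning
  x = toℕ i
-- All odd places come before the even ones, so this order cannot occur.
zigzag-adjacent {i = i} {j} (next j≡1+i) (even o≤i _) (odd j<o _) =
  contradiction j<o (<-asym (begin-strict
    toℕ (opposite j)  <⟨ n<1+n _ ⟩
    _                 ≡⟨ next-opposite {i = i} {j} j≡1+i ⟨
    toℕ (opposite i)  ≤⟨ o≤i ⟩
    toℕ i             ≤⟨ n≤1+n _ ⟩
    suc (toℕ i)       ≡⟨ j≡1+i ⟨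
    toℕ j             ∎))
  where open ≤-Reasoning
zigzag-adjacent {i = i} {j} {u} {v} (next j≡1+i) (even _ u≡2o) (even _ v≡2o′) = inj₂ (begin
  ∣ toℕ u - toℕ v ∣                        ≡⟨ cong₂ ∣_-_∣
    (trans u≡2o (cong (λ x → x + x) (next-opposite {i = i} {j} j≡1+i))) v≡2o′ ⟩
  ∣ suc o + suc o - o + o ∣                ≡⟨ cong (∣_- o + o ∣) (trans (double-suc o) (+-comm 2 (o + o))) ⟩
  ∣ o + o + 2 - o + o ∣                    ≡⟨ ∣-∣-comm (o + o + 2) (o + o) ⟩
  ∣ o + o - o + o + 2 ∣                    ≡⟨ ∣m-m+n∣≡n (o + o) 2 ⟩
  2                                        ∎)
  where
  open ≡-Reasoning
  o = toℕ (opposite j)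

-- Adding 2 keeps the parity, so both places lie in the same half. Values rise along the odd half
-- and fall along the even half, which accounts for the two directions.
zigzag-+2⇒step : {i j u v : Fin (suc m)} → Zigzag j u → Zigzag i v → toℕ v ≡ 2 + toℕ u → Step j i ⊎ Step i j
zigzag-+2⇒step {i = i} {j} {u} {v} (odd _ u≡1+2j) (odd _ v≡1+2i) v≡2+u =
  inj₁ (next (double-injective (toℕ i) (suc (toℕ j)) (suc-injective (begin
    suc (toℕ i + toℕ i)              ≡⟨ v≡1+2i ⟨
    toℕ v                            ≡⟨ v≡2+u ⟩
    2 + toℕ u                        ≡⟨ cong (2 +_) u≡1+2j ⟩
    3 + (toℕ j + toℕ j)              ≡⟨ cong suc (double-suc (toℕ j)) ⟨
    suc (suc (toℕ j) + suc (toℕ j))  ∎))))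
  where open ≡-Reasoning
zigzag-+2⇒step {i = i} {j} (odd _ u≡1+2j) (even _ v≡2o) v≡2+u = contradiction
  (trans (sym v≡2o) (trans v≡2+u (trans (cong (2 +_) u≡1+2j) (cong suc (sym (double-suc (toℕ j)))))))
  (double≢suc-double (toℕ (opposite i)) (suc (toℕ j)))
zigzag-+2⇒step {i = i} {j} (even _ u≡2o) (odd _ v≡1+2i) v≡2+u = contradiction
  (trans (double-suc (toℕ (opposite j))) (trans (cong (2 +_) (sym u≡2o)) (trans (sym v≡2+u) v≡1+2i)))
  (double≢suc-double (suc (toℕ (opposite j))) (toℕ i))
zigzag-+2⇒step {i = i} {j} {u} {v} (even _ u≡2o) (even _ v≡2o′) v≡2+u =
  inj₂ (subst₂ Step (opposite-involutive i) (opposite-involutive j) (step-opposite (next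
  (double-injective (toℕ (opposite i)) (suc (toℕ (opposite j))) (begin
    toℕ (opposite i) + toℕ (opposite i)              ≡⟨ v≡2o′ ⟨
    toℕ v                                            ≡⟨ v≡2+u ⟩
    2 + toℕ u                                        ≡⟨ cong (2 +_) u≡2o ⟩
    2 + (toℕ (opposite j) + toℕ (opposite j))        ≡⟨ double-suc (toℕ (opposite j)) ⟨
    suc (toℕ (opposite j)) + suc (toℕ (opposite j))  ∎)))))
  where open ≡-Reasoning

zigzagWord : ∀ m → Word (suc m)
zigzagWord m = tabulate (proj₁ ∘ zigzag-total)

lookup-zigzagWord : (i : Fin (suc m)) → Zigzag i (lookup (zigzagWord m) i)
lookup-zigzagWord i = subst (Zigzag i) (sym (lookup∘tabulate (proj₁ ∘ zigzag-total) i)) (proj₂ (zigzag-total i))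

zigzagWord-isNecklace : IsNecklace 1 2 (zigzagWord (suc m))
zigzagWord-isNecklace = isNecklace
  (λ x → let i , z = zigzag-surjective x in
    i , zigzag-functional (lookup-zigzagWord i) z ,
    λ {j} eq → zigzag-injective z (subst (Zigzag j) eq (lookup-zigzagWord j)))
  (λ i → zigzag-adjacent (step-shift i) (lookup-zigzagWord i) (lookup-zigzagWord (shift 1 i)))

-- Uniqueness

adjacent-bound : ∀ {n} (x y : Fin n) → Adjacent 1 2 x y → toℕ x ≤ 2 + toℕ y
adjacent-bound x y adj = begin
  toℕ x                        ≤⟨ m≤n+∣m-n∣ (toℕ x) (toℕ y) ⟩
  toℕ y + ∣ toℕ x - toℕ y ∣    ≤⟨ +-monoʳ-≤ (toℕ y) (distance adj) ⟩
  toℕ y + 2                    ≡⟨ +-comm (toℕ y) 2 ⟩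
  2 + toℕ y                    ∎
  where
  open ≤-Reasoning
  distance : Adjacent 1 2 x y → ∣ toℕ x - toℕ y ∣ ≤ 2
  distance (inj₁ eq) = ≤-trans (≤-reflexive eq) (s≤s z≤n)
  distance (inj₂ eq) = ≤-reflexive eq

-- Here g stands for a necklace read through a symmetry that brings 0 to the last place and 1 to the
-- first.
module _ (g : Fin (suc (suc m)) → Fin (suc (suc m)))
         (g-injective : ∀ {i j} → g i ≡ g j → i ≡ j)
         (g-adjacent : ∀ {i j} → Step i j → Adjacent 1 2 (g i) (g j))
         (g-last : g (opposite zero) ≡ zero)
         (g-first : g zero ≡ suc zero)
  where

  zigzag-unique : ∀ {i v} → Zigzag i v → g i ≡ v
  -- The induction is on the value and leaves the place free. The variable k stands for `toℕ v`, so
  -- that `main` can split on 0, 1 and `suc (suc k)`.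
  zigzag-unique z = <-rec (λ k → ∀ {i v} → toℕ v ≡ k → Zigzag i v → g i ≡ v) main _ refl z
    where
    main : ∀ k → (∀ {l} → l < k → ∀ {i v} → toℕ v ≡ l → Zigzag i v → g i ≡ v) →
           ∀ {i v} → toℕ v ≡ k → Zigzag i v → g i ≡ v
    main 0 _ v≡0 (odd _ v≡1+2i) = case trans (sym v≡0) v≡1+2i of λ ()
    main 0 _ {i} {v} v≡0 (even _ v≡2o) = begin
      g i                        ≡⟨ cong g (opposite-involutive i) ⟨
      g (opposite (opposite i))  ≡⟨ cong (g ∘ opposite) o≡0 ⟩
      g (opposite zero)          ≡⟨ g-last ⟩
      zero                       ≡⟨ toℕ-injective v≡0 ⟨
      v                          ∎
      where
      open ≡-Reasoning
      o≡0 : opposite i ≡ zero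
      o≡0 = toℕ-injective (double-injective (toℕ (opposite i)) 0 (trans (sym v≡2o) v≡0))
    main 1 _ {i} {v} v≡1 (odd _ v≡1+2i) = begin
      g i       ≡⟨ cong g i≡0 ⟩
      g zero    ≡⟨ g-first ⟩
      suc zero  ≡⟨ toℕ-injective v≡1 ⟨
      v         ∎
      where
      open ≡-Reasoning
      i≡0 : i ≡ zero
      i≡0 = toℕ-injective (double-injective (toℕ i) 0 (suc-injective (trans (sym v≡1+2i) v≡1)))
    main 1 _ {i} v≡1 (even _ v≡2o) =
      contradiction (trans (sym v≡2o) v≡1) (double≢suc-double (toℕ (opposite i)) 0)
    main (suc (suc k)) rec {i} {v} v≡2+k z = toℕ-injective (≤-antisym upper (≮⇒≥ lower))
      where
      k<n : k < suc (suc _)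
      k<n = <-trans (≤-trans (n<1+n k) (n≤1+n _)) (subst (_< _) v≡2+k (toℕ<n v))
      u = fromℕ< k<n
      u≡k : toℕ u ≡ k
      u≡k = toℕ-fromℕ< k<n
      v≡2+u : toℕ v ≡ 2 + toℕ u
      v≡2+u = trans v≡2+k (cong (2 +_) (sym u≡k))
      j = proj₁ (zigzag-surjective u)
      gj≡u : g j ≡ u
      gj≡u = rec (s≤s (n≤1+n k)) u≡k (proj₂ (zigzag-surjective u))
      neighbours : Adjacent 1 2 (g i) (g j)
      neighbours with zigzag-+2⇒step (proj₂ (zigzag-surjective u)) z v≡2+u
      ... | inj₁ s = adjacent-sym (g j) (g i) (g-adjacent s)
      ... | inj₂ s = g-adjacent s
      upper : toℕ (g i) ≤ toℕ v
      upper = subst (toℕ (g i) ≤_) (trans (cong (λ x → 2 + toℕ x) gj≡u) (sym v≡2+u))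
                    (adjacent-bound (g i) (g j) neighbours)
      lower : ¬ (toℕ (g i) < toℕ v)
      -- A smaller value `g i` has its own zigzag place l, and by induction g takes that value at l.
      -- Injectivity forces l to be i, but then the zigzag would have two values at i.
      lower gi<v with zigzag-surjective (g i)
      ... | l , zₗ with g-injective (rec (subst (_ <_) v≡2+k gi<v) refl zₗ)
      ... | refl = <⇒≢ gi<v (cong toℕ (zigzag-functional zₗ z))

-- Bringing an arbitrary necklace into zigzag form

necklace-injective : ∀ {a b n} {w : Word n} → IsNecklace a b w → ∀ {i j} → lookup w i ≡ lookup w j → i ≡ j
necklace-injective {w = w} necklace {i} {j} eq =
  let _ , _ , unique = IsNecklace.eachOnce necklace (lookup w j) in trans (sym (unique eq)) (unique refl)

necklace-symmetry-adjacent : ∀ {a b} {w : Word (suc m)} {σ} → IsNecklace a b w → IsSymmetry σ →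
  ∀ {i j} → Step i j → Adjacent a b (lookup w (σ i)) (lookup w (σ j))
necklace-symmetry-adjacent {a = a} {b} {w} {σ} necklace σ-sym {i} {j} s with symmetry-step σ-sym s
... | inj₁ eq = subst (Adjacent a b (lookup w (σ i)) ∘ lookup w) eq (IsNecklace.adjacent necklace (σ i))
... | inj₂ eq = adjacent-sym (lookup w (σ j)) (lookup w (σ i))
  (subst (Adjacent a b (lookup w (σ j)) ∘ lookup w) eq (IsNecklace.adjacent necklace (σ j)))

adjacent-to-zero : ∀ {n} (x : Fin (3 + n)) → Adjacent 1 2 zero x → x ≡ suc zero ⊎ x ≡ suc (suc zero)
adjacent-to-zero x = map⊎ toℕ-injective toℕ-injective

-- The two neighbours of 0 are distinct and belong to 1 and 2, so one of them is 1. Both `turn` and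
-- `flip` bring 0 to the last place; `turn` brings its successor on the circle to the first place,
-- `flip` its predecessor.
normalise : {w : Word (3 + m)} → IsNecklace 1 2 w → ∃ λ σ →
            IsSymmetry σ × lookup w (σ (opposite zero)) ≡ zero × lookup w (σ zero) ≡ suc zero
normalise {m} {w} necklace = choose
  (adjacent-to-zero _ (after-last {turn} turn-sym turn-last))
  (adjacent-to-zero _ (after-last {flip} flip-sym flip-last))
  where
  z : Fin (3 + m)
  z = proj₁ (IsNecklace.eachOnce necklace zero)
  wz≡0 : lookup w z ≡ zero
  wz≡0 = proj₁ (proj₂ (IsNecklace.eachOnce necklace zero))
  last→first : Step (opposite zero) (zero {2 + m})
  last→first = wrap (toℕ+opposite {2 + m} zero) refl
  shift-zero : shift (toℕ z) zero ≡ z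
  shift-zero = toℕ-injective (trans (toℕ-shift (toℕ z) zero) (m<n⇒m%n≡m (toℕ<n z)))
  turn flip : Fin (3 + m) → Fin (3 + m)
  turn = shift (1 + toℕ z)
  flip = shift (toℕ z) ∘ opposite
  turn-sym : IsSymmetry turn
  turn-sym = inj₁ (_ , λ _ → refl)
  flip-sym : IsSymmetry flip
  flip-sym = inj₂ (_ , λ _ → refl)
  turn-last : lookup w (turn (opposite zero)) ≡ zero
  turn-last = trans (cong (lookup w) (begin
    shift (1 + toℕ z) (opposite zero)          ≡⟨ shift-shift (toℕ z) 1 (opposite zero) ⟨
    shift (toℕ z) (shift 1 (opposite zero))    ≡⟨ cong (shift (toℕ z)) (step⇒shift last→first) ⟩
    shift (toℕ z) zero                         ≡⟨ shift-zero ⟩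
    z                                          ∎)) wz≡0
    where open ≡-Reasoning
  flip-last : lookup w (flip (opposite zero)) ≡ zero
  flip-last = trans (cong (lookup w) (trans (cong (shift (toℕ z)) (opposite-involutive zero)) shift-zero)) wz≡0
  after-last : ∀ {σ} → IsSymmetry σ → lookup w (σ (opposite zero)) ≡ zero →
               Adjacent 1 2 zero (lookup w (σ zero))
  after-last {σ} σ-sym eq = subst (λ x → Adjacent 1 2 x (lookup w (σ zero))) eq
    (necklace-symmetry-adjacent necklace σ-sym last→first)
  choose : lookup w (turn zero) ≡ suc zero ⊎ lookup w (turn zero) ≡ suc (suc zero) →
           lookup w (flip zero) ≡ suc zero ⊎ lookup w (flip zero) ≡ suc (suc zero) →
           ∃ λ σ → IsSymmetry σ × lookup w (σ (opposite zero)) ≡ zero × lookup w (σ zero) ≡ suc zero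
  choose (inj₁ eq) _ = turn , turn-sym , turn-last , eq
  choose _ (inj₁ eq) = flip , flip-sym , flip-last , eq
  -- If both neighbours were 2, the places one step after and one step before z would coincide.
  -- Rotating z away equates place 1 with the last place, which is impossible for length at least 3.
  choose (inj₂ p) (inj₂ q) = contradiction {A = suc zero ≡ opposite zero}
    (symmetry-injective {σ = shift (toℕ z)} (inj₁ (_ , λ _ → refl)) {suc zero} {opposite zero} (begin
      shift (toℕ z) (suc zero)              ≡⟨ cong (shift (toℕ z)) (step⇒shift {i = zero} (next refl)) ⟨
      shift (toℕ z) (shift 1 zero)          ≡⟨ shift-shift (toℕ z) 1 zero ⟩
      turn zero                             ≡⟨ necklace-injective necklace (trans p (sym q)) ⟩
      shift (toℕ z) (opposite zero)         ∎))
    (λ eq → case trans (cong toℕ eq) (toℕ+opposite {2 + m} zero) of λ ())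
    where open ≡-Reasoning

necklace-zigzag : {w : Word (3 + m)} → IsNecklace 1 2 w → ∃ λ σ →
                  IsSymmetry σ × lookup w ∘ σ ≗ lookup (zigzagWord (2 + m))
necklace-zigzag {w = w} necklace =
  let σ , σ-sym , last , first = normalise necklace in
  σ , σ-sym , λ i → zigzag-unique (lookup w ∘ σ)
    (λ eq → symmetry-injective σ-sym (necklace-injective necklace eq))
    (necklace-symmetry-adjacent necklace σ-sym) last first (lookup-zigzagWord i)

-- Both words agree with the zigzag after symmetries σ and τ, so v is w read through τ after the
-- inverse of σ.
necklaces-same : {v w : Word (3 + m)} → IsNecklace 1 2 v → IsNecklace 1 2 w → Same v w
necklaces-same {v = v} {w} p q =
  let σ , σ-sym , vσ≗ = necklace-zigzag p
      τ , τ-sym , wτ≗ = necklace-zigzag q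
      σ⁻¹ , σ⁻¹-sym , _ , σσ⁻¹ = symmetry-inverse σ-sym
  in symmetry⇒same {v = v} {w} (∘-isSymmetry τ-sym σ⁻¹-sym) λ i →
       trans (cong (lookup v) (sym (σσ⁻¹ i))) (trans (vσ≗ (σ⁻¹ i)) (sym (wτ≗ (σ⁻¹ i))))

-- Counting the classes

length-deduplicate-total : ∀ {A : Set} {P : A → Set} {R : Rel A 0ℓ} (R? : Decidable R) {x xs} →
  (∀ {y z} → P y → P z → R y z) → All P xs → x ∈ xs → length (deduplicate R? xs) ≡ 1
-- The membership proof excludes the empty list. The head is kept, and everything after it is
-- related to it and hence filtered out.
length-deduplicate-total R? {xs = _ ∷ _} total (py ∷ pxs) _ =
  cong (suc ∘ length) (filter-none _ (mapAll (λ pz ¬r → ¬r (total py pz)) (deduplicate⁺ R? pxs)))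

mainTheorem3 : (n : ℕ) → n ≥ 3 → N 1 2 n ≡ 1
mainTheorem3 n@(suc (suc (suc m))) _ = length-deduplicate-total same?
  (λ {v} {w} → necklaces-same {v = v} {w})
  (all-filter (isNecklace? 1 2) (words n))
  -- The zigzag witnesses that at least one necklace is listed.
  (∈-filter⁺ (isNecklace? 1 2) (∈-words (zigzagWord (2 + m))) zigzagWord-isNecklace)
mainTheorem3 1 (s≤s ())
mainTheorem3 2 (s≤s (s≤s ()))
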